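{- Let $D$ be a division $p$-algebra with $\operatorname{char}D=p>2$ and with centre $Z(D)=F$. Suppose $Z(\bar D)=\bar D$ and $\bar D/\bar F$ is a simple purely inseparable extension, $\bar D=\bar F(a)$. Suppose that the semilocal height $i(u)$, which does not depend on the embedding $u$ in this case, is not divisible by $p$. Then $d_D(a)>i(u)$.
   Context: Let $k$ be a field of characteristic $p$, $F=k((t))$, and let $D$ be a division algebra finite dimensional over its centre $F$; $D$ is a $p$-algebra, i.e. its index is a power of $p=\operatorname{char}D$. The $t$-adic valuation extends uniquely to a valuation $w$ on $D$, normalized so that its value group $\Gamma_D$ is $\mathbb Z$. $V_D$, $M_D$, $\bar D=V_D/M_D$ denote valuation ring, maximal ideal and residue division ring (similarly for $F$). A parameter of $D$ is an element $z$ with $w(z)=1$. An embedding $u:\bar D\hookrightarrow D$ is a ring homomorphism $\bar D\to V_D$ that is a section of the residue map; $D$ is splittable if one exists. (The algebra $D$ in the statement is splittable.) Given a parameter $z$ and an embedding $u$, every element of $D$ is uniquely a convergent series $\sum_{j\ge N}u(a_j)z^j$ with $a_j\in\bar D$. Define the automorphism $\alpha={}^{(z)}\alpha$ of $\bar D$ and maps ${}^{(z,u)}_m\delta_i:\bar D\to\bar D$ ($m\in\mathbb Z$, $i\ge1$) by $$z^mu(b)z^{ -m}=u(\alpha^m(b))+u({}^{(z,u)}_m\delta_1(b))z+u({}^{(z,u)}_m\delta_2(b))z^2+\cdots,\qquad b\in\bar D,$$ and ${}^{(z,u)}\delta_i={}^{(z,u)}_1\delta_i$. In the situation of the statement $\alpha=\mathrm{id}$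 for every $z$. The local height is $i(u,z)=\min_{b\in\bar D}w(zu(b)z^{ -1}-u(b))$. A parameter $z$ is called appropriate (for $u$) if ${}^{(z,u)}\delta_{i(u,z)}|_{Z(\bar D)}\neq0$. The semilocal height is $i(u)=\max_z i(u,z)$, equal to $i(u,z)$ for an appropriate parameter $z$. For $b\in Z(\bar D)$ with $\alpha(b)=b$, $i(u,b)$ denotes the minimal positive integer $i$ with ${}^{(z,u)}\delta_i(b)\ne0$, i.e. $i(u,b)=w(zu(b)z^{ -1}-u(b))$; it does not depend on $z$. Finally, $$d_D(a)=\max_{u,z}\,w\Bigl(z^{ -i(u,a)}u(a)z^{i(u,a)}-u(a)-u\bigl({}^{(z,u)}_{ -i(u,a)}\delta_{i(u,a)}(a)\bigr)z^{i(u,a)}\Bigr)\in\mathbb N\cup\{\infty\},$$ where $u$ runs over embeddings and $z$ over appropriate parameters. -}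

module Defs where

open import Level using (0ℓ; _⊔_) renaming (suc to lsuc)
open import Algebra.Bundles using (AbelianGroup; Ring; CommutativeRing; RawRing)
open import Algebra.Morphism.Structures using (module RingMorphisms)
import Algebra.Properties.AbelianGroup as AbelianGroupProperties
import Algebra.Properties.CommutativeSemigroup as CommutativeSemigroupProperties
import Algebra.Properties.Monoid.Mult as Mult
import Algebra.Properties.Monoid.Sum as Sum
import Algebra.Properties.Ring as RingProperties
import Algebra.Properties.Semiring.Exp as Exp
open import Data.Empty using (⊥-elim)
open import Data.Fin.Base using (toℕ)
open import Data.Integer.Base as ℤ using (ℤ; +_; -[1+_]; 0ℤ; 1ℤ)
import Data.Integer.Properties as ℤ
open import Data.Nat.Base as ℕ using (ℕ; zero; suc)
open import Data.Nat.Divisibility using (_∣_)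
open import Data.Product.Base using (Σ; ∃-syntax; _×_; _,_; proj₁; proj₂)
open import Data.Vec.Functional using (Vector)
open import Function.Bundles using (_⇔_; module Equivalence)
open import Relation.Binary.PropositionalEquality as ≡ using (_≡_)
open import Relation.Nullary.Construct.Add.Supremum public
  using (_⁺; ⊤⁺; [_]; []-injective)
open import Relation.Nullary.Negation.Core using (¬_)
open import Relation.Unary using (Pred; _∈_)

open import Relation.Binary.Construct.Add.Supremum.NonStrict ℤ._≤_ public
open import Relation.Binary.Construct.Add.Supremum.Strict ℤ._<_ public

ℤ∞ : Set
ℤ∞ = ℤ ⁺

infixl 6 _+∞_

_+∞_ : ℤ∞ → ℤ∞ → ℤ∞
[ m ] +∞ [ n ] = [ m ℤ.+ n ]
[ m ] +∞ ⊤⁺    = ⊤⁺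
⊤⁺    +∞ _     = ⊤⁺

IsMinimum : ∀ {ℓ} → Pred ℤ∞ ℓ → ℤ∞ → Set ℓ
IsMinimum P m = m ∈ P × (∀ {v} → v ∈ P → m ≤⁺ v)

IsMaximum : ∀ {ℓ} → Pred ℤ∞ ℓ → ℤ∞ → Set ℓ
IsMaximum P m = m ∈ P × (∀ {v} → v ∈ P → v ≤⁺ m)

-- In contrast to IsMaximum, an unbounded set of integers has the
-- supremum ∞ without having to contain it, and the empty set has no
-- supremum.
IsSupremum : ∀ {ℓ} → Pred ℤ∞ ℓ → ℤ∞ → Set ℓ
IsSupremum P s = (∀ {v} → v ∈ P → v ≤⁺ s) ×
                 (∀ s′ → (∀ {v} → v ∈ P → v ≤⁺ s′) → s ≤⁺ s′)

≤∞-refl : ∀ {v} → v ≤⁺ v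
≤∞-refl = ≤⁺-reflexive-≡ ℤ.≤-reflexive ≡.refl

≤∞-trans : ∀ {u v w} → u ≤⁺ v → v ≤⁺ w → u ≤⁺ w
≤∞-trans = ≤⁺-trans ℤ.≤-trans

≤∞-resp : ∀ {m v w} → v ≡ w → m ≤⁺ v → m ≤⁺ w
≤∞-resp ≡.refl p = p

+∞-mono-≤ : ∀ {m n v w} → [ m ] ≤⁺ v → [ n ] ≤⁺ w → [ m ℤ.+ n ] ≤⁺ v +∞ w
+∞-mono-≤ {v = [ _ ]} {[ _ ]} [ p ] [ q ] = [ ℤ.+-mono-≤ p q ]
+∞-mono-≤ {v = [ _ ]} {⊤⁺}    _     _     = _ ≤⊤⁺
+∞-mono-≤ {v = ⊤⁺}            _     _     = _ ≤⊤⁺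

0<⇒1≤ : ∀ {v} → [ 0ℤ ] <⁺ v → [ 1ℤ ] ≤⁺ v
0<⇒1≤ [ p ]     = [ ℤ.i<j⇒suc[i]≤j p ]
0<⇒1≤ [ _ ]<⊤⁺  = _ ≤⊤⁺

1≤⇒0< : ∀ {v} → [ 1ℤ ] ≤⁺ v → [ 0ℤ ] <⁺ v
1≤⇒0< {[ _ ]} [ p ] = [ ℤ.suc[i]≤j⇒i<j p ]
1≤⇒0< {⊤⁺}    _     = [ 0ℤ ]<⊤⁺

1≤⇒0≤ : ∀ {v} → [ 1ℤ ] ≤⁺ v → [ 0ℤ ] ≤⁺ v
1≤⇒0≤ = ≤∞-trans [ ℤ.+≤+ ℕ.z≤n ]

HasCharacteristic : ∀ {c ℓ} → Ring c ℓ → ℕ → Set ℓ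
HasCharacteristic R p = ∀ n → (n · 1# ≈ 0#) ⇔ (p ∣ n)
  where
  open Ring R using (1#; 0#; _≈_; +-monoid)
  open Mult +-monoid using () renaming (_×_ to _·_)

Central : ∀ {c ℓ} (R : Ring c ℓ) → Pred (Ring.Carrier R) (c ⊔ ℓ)
Central R x = ∀ y → x * y ≈ y * x
  where open Ring R using (_*_; _≈_)

record IsDivisionRing {c ℓ} (R : Ring c ℓ) : Set (c ⊔ ℓ) where
  open Ring R
  field
    1≉0     : ¬ 1# ≈ 0#
    inverse : ∀ x → ¬ x ≈ 0# → ∃[ y ] (x * y ≈ 1#) × (y * x ≈ 1#)

record Field c ℓ : Set (lsuc (c ⊔ ℓ)) where
  field
    commutativeRing : CommutativeRing c ℓ
  open CommutativeRing commutativeRing public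
  field
    isDivisionRing : IsDivisionRing ring

module Laurent {c ℓ} (k : Field c ℓ) where
  open Field k
  open Sum +-monoid using (sum)

  infix 5 t^_·_

  -- t^ N · a  represents  t^N (a₀ + a₁t + a₂t² + …); a₀ may be zero.
  record LaurentSeries : Set c where
    constructor t^_·_
    field
      shift  : ℤ
      coeffs : ℕ → Carrier
  open LaurentSeries

  coeff : LaurentSeries → ℤ → Carrier
  coeff (t^ N · a) n with n ℤ.- N
  ... | + i      = a i
  ... | -[1+ _ ] = 0#

  _≈ᴸ_ : LaurentSeries → LaurentSeries → Set ℓ
  f ≈ᴸ g = ∀ n → coeff f n ≈ coeff g n

  constant : Carrier → ℕ → Carrier
  constant x zero    = x
  constant x (suc _) = 0#

  _+ᴸ_ : LaurentSeries → LaurentSeries → LaurentSeries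
  f +ᴸ g = t^ N · λ i → coeff f (N ℤ.+ + i) + coeff g (N ℤ.+ + i)
    where
    N : ℤ
    N = shift f ℤ.⊓ shift g

  _*ᴸ_ : LaurentSeries → LaurentSeries → LaurentSeries
  (t^ M · a) *ᴸ (t^ N · b) =
    t^ M ℤ.+ N · λ n → sum {suc n} λ i → a (toℕ i) * b (n ℕ.∸ toℕ i)

  laurentRawRing : RawRing c ℓ
  laurentRawRing = record
    { Carrier = LaurentSeries
    ; _≈_     = _≈ᴸ_
    ; _+_     = _+ᴸ_
    ; _*_     = _*ᴸ_
    ; -_      = λ f → t^ shift f · λ i → - coeffs f i
    ; 0#      = t^ 0ℤ · constant 0#
    ; 1#      = t^ 0ℤ · constant 1#
    }

  -- The t-adic valuation of f is n.
  HasOrder : LaurentSeries → ℤ → Set ℓ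
  HasOrder f n = (¬ coeff f n ≈ 0#) × (∀ m → m ℤ.< n → coeff f m ≈ 0#)

record IsValuation {c ℓ} (R : Ring c ℓ) (w : Ring.Carrier R → ℤ∞) : Set (c ⊔ ℓ) where
  open Ring R
  field
    cong        : ∀ {x y} → x ≈ y → w x ≡ w y
    infinite    : ∀ x → (w x ≡ ⊤⁺) ⇔ (x ≈ 0#)
    mult        : ∀ x y → w (x * y) ≡ w x +∞ w y
    -- w (x + y) ≥ min (w x) (w y)
    ultrametric : ∀ {v} x y → v ≤⁺ w x → v ≤⁺ w y → v ≤⁺ w (x + y)

-- A finite dimensional division algebra with centre F = k((t)), together
-- with the valuation w extending the t-adic one.
record DivisionAlgebra {a b} (k : Field a b) c ℓ : Set (a ⊔ b ⊔ lsuc (c ⊔ ℓ)) where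
  open Laurent k using (LaurentSeries; laurentRawRing; _≈ᴸ_; HasOrder)
  module F = RawRing laurentRawRing
  field
    ring : Ring c ℓ
  open Ring ring
  open RingMorphisms laurentRawRing rawRing using (IsRingMonomorphism)
  open Sum +-monoid using (sum)
  field
    isDivisionRing : IsDivisionRing ring

    ι              : LaurentSeries → Carrier
    ι-monomorphism : IsRingMonomorphism ι
    ι-central      : ∀ f → Central ring (ι f)
    central-ι      : ∀ x → Central ring x → ∃[ f ] ι f ≈ x

    dim            : ℕ
    basis          : Vector Carrier dim

  linearCombination : Vector LaurentSeries dim → Carrier
  linearCombination f = sum λ i → ι (f i) * basis i

  field
    spanning       : ∀ x → ∃[ f ] x ≈ linearCombination f
    independent    : ∀ f → linearCombination f ≈ 0# → ∀ i → f i ≈ᴸ F.0#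

    w              : Carrier → ℤ∞
    isValuation    : IsValuation ring w
    -- On F the normalized w is e times the t-adic valuation, where e is
    -- the ramification index.
    extends        : ∃[ e ] (1 ℕ.≤ e) × (∀ f n → HasOrder f n → w (ι f) ≡ [ + e ℤ.* n ])
    normalized     : ∃[ z ] w z ≡ [ 1ℤ ]

-- The index is the square root of the dimension over the centre.
IsPAlgebra : ∀ {a b c ℓ} {k : Field a b} → ℕ → DivisionAlgebra k c ℓ → Set
IsPAlgebra p D = ∃[ m ] DivisionAlgebra.dim D ≡ p ℕ.^ m ℕ.* p ℕ.^ m

module Residue {a b c ℓ} {k : Field a b} (D : DivisionAlgebra k c ℓ) where
  open DivisionAlgebra D
  open Ring ring hiding (zero)
  open IsDivisionRing isDivisionRing
  open IsValuation isValuation renaming (cong to w-cong)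
  open RingProperties ring using (-1*x≈-x; x[y-z]≈xy-xz; [y-z]x≈yx-zx)
  open AbelianGroupProperties +-abelianGroup
    using (⁻¹-anti-homo‿-; ⁻¹-∙-comm; \\-leftDividesʳ; x≈y⇒x∙y⁻¹≈ε; ⁻¹-involutive; ε⁻¹≈ε)
  open CommutativeSemigroupProperties
    (AbelianGroup.commutativeSemigroup +-abelianGroup) using (interchange)
  open Exp semiring using (_^_)
  open import Relation.Binary.Reasoning.Setoid setoid

  module ℤG = AbelianGroupProperties ℤ.+-0-abelianGroup

  telescope : ∀ x y z → (x - y) + (y - z) ≈ x - z
  telescope x y z = begin
    (x - y) + (y - z)    ≈⟨ +-assoc x (- y) (y - z) ⟩
    x + (- y + (y - z))  ≈⟨ +-congˡ (\\-leftDividesʳ y (- z)) ⟩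
    x - z                ∎

  +-diff : ∀ x x′ y y′ → (x - y) + (x′ - y′) ≈ (x + x′) - (y + y′)
  +-diff x x′ y y′ = begin
    (x - y) + (x′ - y′)      ≈⟨ interchange x (- y) x′ (- y′) ⟩
    (x + x′) + (- y + - y′)  ≈⟨ +-congˡ (⁻¹-∙-comm y y′) ⟩
    (x + x′) - (y + y′)      ∎

  *-diff : ∀ x x′ y y′ → x * (x′ - y′) + (x - y) * y′ ≈ x * x′ - y * y′
  *-diff x x′ y y′ = begin
    x * (x′ - y′) + (x - y) * y′
      ≈⟨ +-cong (x[y-z]≈xy-xz x x′ y′) ([y-z]x≈yx-zx y′ x y) ⟩
    (x * x′ - x * y′) + (x * y′ - y * y′)
      ≈⟨ telescope (x * x′) (x * y′) (y * y′) ⟩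
    x * x′ - y * y′
      ∎

  w-0 : w 0# ≡ ⊤⁺
  w-0 = Equivalence.from (infinite 0#) refl

  w-1 : w 1# ≡ [ 0ℤ ]
  w-1 = idempotent (w 1#) (λ p → 1≉0 (Equivalence.to (infinite 1#) p))
                   (≡.trans (w-cong (sym (*-identityˡ 1#))) (mult 1# 1#))
    where
    idempotent : ∀ v → ¬ v ≡ ⊤⁺ → v ≡ v +∞ v → v ≡ [ 0ℤ ]
    idempotent ⊤⁺    v≢∞ _ = ⊥-elim (v≢∞ ≡.refl)
    idempotent [ n ] _   p = ≡.cong [_] (ℤG.identityʳ-unique n n (≡.sym ([]-injective p)))

  w-[-1] : w (- 1#) ≡ [ 0ℤ ]
  w-[-1] = torsionFree (w (- 1#)) (≡.trans (≡.sym (mult (- 1#) (- 1#)))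
    (≡.trans (w-cong (trans (-1*x≈-x (- 1#)) (⁻¹-involutive 1#))) w-1))
    where
    torsionFree : ∀ v → v +∞ v ≡ [ 0ℤ ] → v ≡ [ 0ℤ ]
    torsionFree [ + zero ] _ = ≡.refl
    torsionFree [ + suc n ] ()
    torsionFree [ -[1+ n ] ] ()

  ≤w-neg : ∀ {m} x → [ m ] ≤⁺ w x → [ m ] ≤⁺ w (- x)
  ≤w-neg {m} x p = ≤∞-resp (≡.trans (≡.sym (mult (- 1#) x)) (w-cong (-1*x≈-x x)))
    (≡.subst (λ n → [ n ] ≤⁺ w (- 1#) +∞ w x) (ℤ.+-identityˡ m)
      (+∞-mono-≤ (≤∞-resp (≡.sym w-[-1]) ≤∞-refl) p))

  ≤w-* : ∀ {m n} x y → [ m ] ≤⁺ w x → [ n ] ≤⁺ w y → [ m ℤ.+ n ] ≤⁺ w (x * y)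
  ≤w-* x y p q = ≤∞-resp (≡.sym (mult x y)) (+∞-mono-≤ p q)

  ≤w-- : ∀ {m} x y → [ m ] ≤⁺ w x → [ m ] ≤⁺ w y → [ m ] ≤⁺ w (x - y)
  ≤w-- x y p q = ultrametric x (- y) p (≤w-neg y q)

  ≤w-0 : ∀ {m x} → x ≈ 0# → m ≤⁺ w x
  ≤w-0 x≈0 = ≤∞-resp (≡.sym (≡.trans (w-cong x≈0) w-0)) (_ ≤⊤⁺)

  V : Set c
  V = ∃[ x ] [ 0ℤ ] ≤⁺ w x

  valuationRing : Ring c ℓ
  valuationRing = record
    { Carrier = V
    ; _≈_ = λ x y → proj₁ x ≈ proj₁ y
    ; _+_ = λ (x , p) (y , q) → x + y , ultrametric x y p q
    ; _*_ = λ (x , p) (y , q) → x * y , ≤w-* x y p q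
    ; -_ = λ (x , p) → - x , ≤w-neg x p
    ; 0# = 0# , ≤w-0 refl
    ; 1# = 1# , ≤∞-resp (≡.sym w-1) ≤∞-refl
    ; isRing = record
      { +-isAbelianGroup = record
        { isGroup = record
          { isMonoid = record
            { isSemigroup = record
              { isMagma = record
                { isEquivalence = record { refl = refl ; sym = sym ; trans = trans }
                ; ∙-cong = +-cong
                }
              ; assoc = λ x y z → +-assoc _ _ _
              }
            ; identity = (λ x → +-identityˡ _) , (λ x → +-identityʳ _)
            }
          ; inverse = (λ x → -‿inverseˡ _) , (λ x → -‿inverseʳ _)
          ; ⁻¹-cong = -‿cong
          }
        ; comm = λ x y → +-comm _ _
        }
      ; *-cong = *-cong
      ; *-assoc = λ x y z → *-assoc _ _ _
      ; *-identity = (λ x → *-identityˡ _) , (λ x → *-identityʳ _)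
      ; distrib = (λ x y z → distribˡ _ _ _) , (λ x y z → distribʳ _ _ _)
      }
    }

  -- D̄ = V_D / M_D: the elements are those of V, with x ≈ᵣ y when
  -- x - y ∈ M_D.

  infix 4 _≈ᵣ_

  _≈ᵣ_ : V → V → Set
  (x , _) ≈ᵣ (y , _) = [ 0ℤ ] <⁺ w (x - y)

  ≈⇒≈ᵣ : ∀ {x y} → proj₁ x ≈ proj₁ y → x ≈ᵣ y
  ≈⇒≈ᵣ p = 1≤⇒0< (≤w-0 (x≈y⇒x∙y⁻¹≈ε p))

  1≤w⇒≈ᵣ : ∀ {x y z} → z ≈ proj₁ x - proj₁ y → [ 1ℤ ] ≤⁺ w z → x ≈ᵣ y
  1≤w⇒≈ᵣ eq p = 1≤⇒0< (≤∞-resp (w-cong eq) p)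

  residueRing : Ring c 0ℓ
  residueRing = record
    { Carrier = V
    ; _≈_ = _≈ᵣ_
    ; _+_ = V._+_
    ; _*_ = V._*_
    ; -_ = V.-_
    ; 0# = V.0#
    ; 1# = V.1#
    ; isRing = record
      { +-isAbelianGroup = record
        { isGroup = record
          { isMonoid = record
            { isSemigroup = record
              { isMagma = record
                { isEquivalence = record
                  { refl = λ {x} → ≈⇒≈ᵣ {x} {x} refl
                  ; sym = λ {x} {y} → ≈ᵣ-sym {x} {y}
                  ; trans = λ {x} {y} {z} → ≈ᵣ-trans {x} {y} {z}
                  }
                ; ∙-cong = λ {x} {y} {x′} {y′} → +-congᵣ {x} {y} {x′} {y′}
                }
              ; assoc = λ x y z → ≈⇒≈ᵣ {(x V.+ y) V.+ z} {x V.+ (y V.+ z)} (+-assoc _ _ _)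
              }
            ; identity = (λ x → ≈⇒≈ᵣ {V.0# V.+ x} {x} (+-identityˡ _))
                       , (λ x → ≈⇒≈ᵣ {x V.+ V.0#} {x} (+-identityʳ _))
            }
          ; inverse = (λ x → ≈⇒≈ᵣ {V.- x V.+ x} {V.0#} (-‿inverseˡ _))
                    , (λ x → ≈⇒≈ᵣ {x V.- x} {V.0#} (-‿inverseʳ _))
          ; ⁻¹-cong = λ {x} {y} → -‿congᵣ {x} {y}
          }
        ; comm = λ x y → ≈⇒≈ᵣ {x V.+ y} {y V.+ x} (+-comm _ _)
        }
      ; *-cong = λ {x} {y} {x′} {y′} → *-congᵣ {x} {y} {x′} {y′}
      ; *-assoc = λ x y z → ≈⇒≈ᵣ {(x V.* y) V.* z} {x V.* (y V.* z)} (*-assoc _ _ _)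
      ; *-identity = (λ x → ≈⇒≈ᵣ {V.1# V.* x} {x} (*-identityˡ _))
                   , (λ x → ≈⇒≈ᵣ {x V.* V.1#} {x} (*-identityʳ _))
      ; distrib = (λ x y z → ≈⇒≈ᵣ {x V.* (y V.+ z)} {x V.* y V.+ x V.* z} (distribˡ _ _ _))
                , (λ x y z → ≈⇒≈ᵣ {(y V.+ z) V.* x} {y V.* x V.+ z V.* x} (distribʳ _ _ _))
      }
    }
    where
    module V = Ring valuationRing

    ≈ᵣ-sym : ∀ {x y} → x ≈ᵣ y → y ≈ᵣ x
    ≈ᵣ-sym {x} {y} p =
      1≤w⇒≈ᵣ {y} {x} (⁻¹-anti-homo‿- (proj₁ x) (proj₁ y)) (≤w-neg _ (0<⇒1≤ p))

    ≈ᵣ-trans : ∀ {x y z} → x ≈ᵣ y → y ≈ᵣ z → x ≈ᵣ z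
    ≈ᵣ-trans {x} {y} {z} p q =
      1≤w⇒≈ᵣ {x} {z} (telescope _ (proj₁ y) _) (ultrametric _ _ (0<⇒1≤ p) (0<⇒1≤ q))

    +-congᵣ : ∀ {x y x′ y′} → x ≈ᵣ y → x′ ≈ᵣ y′ → x V.+ x′ ≈ᵣ y V.+ y′
    +-congᵣ {x} {y} {x′} {y′} p q =
      1≤w⇒≈ᵣ {x V.+ x′} {y V.+ y′} (+-diff _ _ _ _) (ultrametric _ _ (0<⇒1≤ p) (0<⇒1≤ q))

    *-congᵣ : ∀ {x y x′ y′} → x ≈ᵣ y → x′ ≈ᵣ y′ → x V.* x′ ≈ᵣ y V.* y′
    *-congᵣ {x} {y} {x′} {y′} p q =
      1≤w⇒≈ᵣ {x V.* x′} {y V.* y′} (*-diff _ _ _ _)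
        (ultrametric _ _ (≤w-* _ _ (proj₂ x) (0<⇒1≤ q)) (≤w-* _ _ (0<⇒1≤ p) (proj₂ y′)))

    -‿congᵣ : ∀ {x y} → x ≈ᵣ y → V.- x ≈ᵣ V.- y
    -‿congᵣ {x} {y} p =
      1≤w⇒≈ᵣ {V.- x} {V.- y} (sym (⁻¹-∙-comm _ _)) (≤w-neg _ (0<⇒1≤ p))

  module V = Ring valuationRing
  module D̄ = Ring residueRing

  -- The image in D̄ of the valuation ring of F.
  InF̄ : Pred V a
  InF̄ x = ∃[ f ] Σ ([ 0ℤ ] ≤⁺ w (ι f)) λ p → x ≈ᵣ (ι f , p)

  -- The division subring F̄(s) of D̄ generated by F̄ and s.

  data F̄⟨_⟩ (s : V) : Pred V (a ⊔ c) where
    base : ∀ {x} → x ∈ InF̄ → x ∈ F̄⟨ s ⟩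
    gen  : s ∈ F̄⟨ s ⟩
    resp : ∀ {x y} → x ≈ᵣ y → x ∈ F̄⟨ s ⟩ → y ∈ F̄⟨ s ⟩
    add  : ∀ {x y} → x ∈ F̄⟨ s ⟩ → y ∈ F̄⟨ s ⟩ → x D̄.+ y ∈ F̄⟨ s ⟩
    neg  : ∀ {x} → x ∈ F̄⟨ s ⟩ → D̄.- x ∈ F̄⟨ s ⟩
    mul  : ∀ {x y} → x ∈ F̄⟨ s ⟩ → y ∈ F̄⟨ s ⟩ → x D̄.* y ∈ F̄⟨ s ⟩
    inv  : ∀ {x y} → x D̄.* y ≈ᵣ D̄.1# → x ∈ F̄⟨ s ⟩ → y ∈ F̄⟨ s ⟩

  IsPurelyInseparable : ℕ → Set (a ⊔ c)
  IsPurelyInseparable p = ∀ x → ∃[ n ] x ^ᵣ (p ℕ.^ n) ∈ InF̄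
    where open Exp D̄.semiring using () renaming (_^_ to _^ᵣ_)

  record Embedding : Set (c ⊔ ℓ) where
    open RingMorphisms D̄.rawRing V.rawRing using (IsRingHomomorphism)
    field
      map            : V → V
      isHomomorphism : IsRingHomomorphism map
      section        : ∀ x → map x ≈ᵣ x

    ⟦_⟧ : V → Carrier
    ⟦ x ⟧ = proj₁ (map x)

  record Parameter : Set c where
    field
      element : Carrier
      value   : w element ≡ [ 1ℤ ]

    private
      invertible : ∃[ y ] (element * y ≈ 1#) × (y * element ≈ 1#)
      invertible = inverse element λ z≈0 → absurd (≡.trans (≡.sym value) (≡.trans (w-cong z≈0) w-0))
        where
        absurd : ∀ {m} → ¬ [ m ] ≡ ⊤⁺
        absurd ()

    element⁻¹ : Carrier
    element⁻¹ = proj₁ invertible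

    inverseʳ : element * element⁻¹ ≈ 1#
    inverseʳ = proj₁ (proj₂ invertible)

    inverseˡ : element⁻¹ * element ≈ 1#
    inverseˡ = proj₂ (proj₂ invertible)

  open Embedding using (⟦_⟧)
  open Parameter using (element; element⁻¹)

  infixr 8 _^ᶻ_

  _^ᶻ_ : Parameter → ℤ → Carrier
  z ^ᶻ (+ n)    = element z ^ n
  z ^ᶻ -[1+ n ] = element⁻¹ z ^ suc n

  conj : Parameter → ℤ → Carrier → Carrier
  conj z m x = z ^ᶻ m * x * z ^ᶻ (ℤ.- m)

  w-element⁻¹ : ∀ z → w (element⁻¹ z) ≡ [ ℤ.- 1ℤ ]
  w-element⁻¹ z = solve (w (element⁻¹ z))
    (≡.trans (≡.cong (_+∞ w (element⁻¹ z)) (≡.sym (Parameter.value z)))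
      (≡.trans (≡.sym (mult _ _)) (≡.trans (w-cong (Parameter.inverseʳ z)) w-1)))
    where
    solve : ∀ v → [ 1ℤ ] +∞ v ≡ [ 0ℤ ] → v ≡ [ ℤ.- 1ℤ ]
    solve [ n ] p = ≡.cong [_] (ℤG.inverseʳ-unique 1ℤ n ([]-injective p))

  w-^ : ∀ {e} x → w x ≡ [ e ] → ∀ n → w (x ^ n) ≡ [ + n ℤ.* e ]
  w-^ {e} x p zero    = w-1
  w-^ {e} x p (suc n) = ≡.trans (mult x (x ^ n))
    (≡.trans (≡.cong₂ _+∞_ p (w-^ x p n)) (≡.cong [_] (≡.sym (ℤ.suc-* (+ n) e))))

  w-^ᶻ : ∀ z m → w (z ^ᶻ m) ≡ [ m ]
  w-^ᶻ z (+ n)    =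
    ≡.trans (w-^ (element z) (Parameter.value z) n) (≡.cong [_] (ℤ.*-identityʳ (+ n)))
  w-^ᶻ z -[1+ n ] =
    ≡.trans (w-^ (element⁻¹ z) (w-element⁻¹ z) (suc n))
    (≡.cong [_] (≡.trans (ℤ.*-comm (+ suc n) (ℤ.- 1ℤ)) (ℤ.-1*i≡-i (+ suc n))))

  conj-integral : ∀ z m x → [ 0ℤ ] ≤⁺ w x → [ 0ℤ ] ≤⁺ w (conj z m x)
  conj-integral z m x p = ≡.subst (λ n → [ n ] ≤⁺ w (conj z m x))
    (≡.trans (≡.cong (ℤ._+ ℤ.- m) (ℤ.+-identityʳ m)) (ℤ.+-inverseʳ m))
    (≤w-* _ _ (≤w-* _ _ (exact m) p) (exact (ℤ.- m)))
    where
    exact : ∀ n → [ n ] ≤⁺ w (z ^ᶻ n)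
    exact n = ≤∞-resp (≡.sym (w-^ᶻ z n)) ≤∞-refl

  module Series (u : Embedding) (z : Parameter) where

    partialSum : (ℕ → V) → ℕ → Carrier
    partialSum a zero    = 0#
    partialSum a (suc n) = partialSum a n + ⟦ u ⟧ (a n) * element z ^ n

    -- x = Σ_{j ≥ 0} u(a_j) z^j
    IsExpansion : Carrier → (ℕ → V) → Set
    IsExpansion x a = ∀ n → [ + n ] ≤⁺ w (x - partialSum a n)

    remainder : V → ℕ → V
    remainder x zero    = x
    remainder x (suc n) = (r - ⟦ u ⟧ (remainder x n)) * element⁻¹ z
      , ≤w-* _ _ (0<⇒1≤ (D̄.sym {Embedding.map u (remainder x n)} {remainder x n}
                           (Embedding.section u (remainder x n))))
                 (≤∞-resp (≡.sym (w-element⁻¹ z)) ≤∞-refl)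
      where
      r : Carrier
      r = proj₁ (remainder x n)

    remainder-step : ∀ x n → proj₁ (remainder x (suc n)) * element z ≈
                             proj₁ (remainder x n) - ⟦ u ⟧ (remainder x n)
    remainder-step x n = trans (*-assoc _ _ _)
      (trans (*-congˡ (Parameter.inverseˡ z)) (*-identityʳ _))

    remainder-sum : ∀ x n → proj₁ x - partialSum (remainder x) n ≈
                            proj₁ (remainder x n) * element z ^ n
    remainder-sum x zero = begin
      proj₁ x - 0#   ≈⟨ +-congˡ ε⁻¹≈ε ⟩
      proj₁ x + 0#   ≈⟨ +-identityʳ _ ⟩
      proj₁ x        ≈⟨ *-identityʳ _ ⟨
      proj₁ x * 1#   ∎
    remainder-sum x (suc n) = begin
      proj₁ x - (S + u[r] * z^n)        ≈⟨ +-congˡ (⁻¹-∙-comm S (u[r] * z^n)) ⟨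
      proj₁ x + (- S - u[r] * z^n)      ≈⟨ +-assoc (proj₁ x) (- S) (- (u[r] * z^n)) ⟨
      (proj₁ x - S) - u[r] * z^n        ≈⟨ +-congʳ (remainder-sum x n) ⟩
      r * z^n - u[r] * z^n              ≈⟨ [y-z]x≈yx-zx z^n r u[r] ⟨
      (r - u[r]) * z^n                  ≈⟨ *-congʳ (remainder-step x n) ⟨
      r⁺ * element z * z^n              ≈⟨ *-assoc r⁺ (element z) z^n ⟩
      r⁺ * (element z * z^n)            ∎
      where
      S r r⁺ u[r] z^n : Carrier
      S = partialSum (remainder x) n
      r = proj₁ (remainder x n)
      r⁺ = proj₁ (remainder x (suc n))
      u[r] = ⟦ u ⟧ (remainder x n)
      z^n = element z ^ n

    expansion : ∀ x → ∃[ a ] IsExpansion (proj₁ x) a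
    expansion x = remainder x , λ n → ≤∞-resp (w-cong (sym (remainder-sum x n)))
      (≡.subst (λ m → [ m ] ≤⁺ w (proj₁ (remainder x n) * element z ^ n)) (ℤ.+-identityˡ (+ n))
        (≤w-* _ _ (proj₂ (remainder x n)) (≤∞-resp (≡.sym (w-^ᶻ z (+ n))) ≤∞-refl)))

    expansion-unique : ∀ {x a b} → IsExpansion x a → IsExpansion x b → ∀ n → a n ≈ᵣ b n
    expansion-unique {x} {a} {b} p q n = coefficients n (sums n)
      where
      d : ℕ → Carrier
      d n = ⟦ u ⟧ (a n) - ⟦ u ⟧ (b n)

      difference : ∀ n → partialSum a n ≈ partialSum b n →
                   - (x - partialSum a (suc n)) + (x - partialSum b (suc n)) ≈
                   d n * element z ^ n
      difference n Sa≈Sb = begin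
        - (x - Sa⁺) + (x - Sb⁺)            ≈⟨ +-congʳ (⁻¹-anti-homo‿- x Sa⁺) ⟩
        (Sa⁺ - x) + (x - Sb⁺)              ≈⟨ telescope Sa⁺ x Sb⁺ ⟩
        Sa⁺ - Sb⁺                          ≈⟨ +-diff Sa ua (partialSum b n) ub ⟨
        (Sa - partialSum b n) + (ua - ub)  ≈⟨ +-congʳ (x≈y⇒x∙y⁻¹≈ε Sa≈Sb) ⟩
        0# + (ua - ub)                     ≈⟨ +-identityˡ _ ⟩
        ua - ub                            ≈⟨ [y-z]x≈yx-zx _ _ _ ⟨
        d n * element z ^ n                ∎
        where
        Sa Sa⁺ Sb⁺ ua ub : Carrier
        Sa = partialSum a n
        Sa⁺ = partialSum a (suc n)
        Sb⁺ = partialSum b (suc n)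
        ua = ⟦ u ⟧ (a n) * element z ^ n
        ub = ⟦ u ⟧ (b n) * element z ^ n

      cancel : ∀ n v → [ + suc n ] ≤⁺ v +∞ [ + n ] → [ 1ℤ ] ≤⁺ v
      cancel n ⊤⁺    _     = _ ≤⊤⁺
      cancel n [ m ] [ r ] = [ ≡.subst₂ ℤ._≤_
        (ℤG.//-rightDividesʳ (+ n) 1ℤ) (ℤG.//-rightDividesʳ (+ n) m)
        (ℤ.+-monoˡ-≤ (ℤ.- (+ n)) r) ]

      coefficients : ∀ n → partialSum a n ≈ partialSum b n → a n ≈ᵣ b n
      coefficients n Sa≈Sb =
        D̄.trans {a n} {Embedding.map u (a n)} {b n}
          (D̄.sym {Embedding.map u (a n)} {a n} (Embedding.section u (a n)))
          (D̄.trans {Embedding.map u (a n)} {Embedding.map u (b n)} {b n}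
            (1≤⇒0< (cancel n (w (d n)) (≤∞-resp
              (≡.trans (w-cong (difference n Sa≈Sb))
                (≡.trans (mult _ _) (≡.cong (w (d n) +∞_) (w-^ᶻ z (+ n)))))
              (ultrametric _ _ (≤w-neg _ (p (suc n))) (q (suc n))))))
            (Embedding.section u (b n)))

      sums : ∀ n → partialSum a n ≈ partialSum b n
      sums zero    = refl
      sums (suc n) = +-cong (sums n) (*-congʳ
        (IsRingHomomorphism.⟦⟧-cong (Embedding.isHomomorphism u) {a n} {b n} (coefficients n (sums n))))
        where open RingMorphisms D̄.rawRing V.rawRing using (module IsRingHomomorphism)

    -- conjCoefficient m i b is the coefficient of z^i in z^m u(b) z^(-m):
    -- it is α^m(b) for i = 0 and ₘδᵢ(b) for i ≥ 1.
    conjCoefficient : ℤ → ℕ → V → V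
    conjCoefficient m i b = proj₁ (expansion (conj z m (⟦ u ⟧ b) , integral)) i
      where
      integral : [ 0ℤ ] ≤⁺ w (conj z m (⟦ u ⟧ b))
      integral = conj-integral z m (⟦ u ⟧ b) (proj₂ (Embedding.map u b))

    α : V → V
    α = conjCoefficient 1ℤ 0

    -- Meaningful for i ≥ 1 only.
    δ[_] : ℤ → ℕ → V → V
    δ[ m ] = conjCoefficient m

    δ : ℕ → V → V
    δ = δ[ 1ℤ ]

  open Series using (α; δ[_]; δ)

  -- i(u,z)
  IsLocalHeight : Embedding → Parameter → ℤ∞ → Set c
  IsLocalHeight u z = IsMinimum λ v → ∃[ b ] v ≡ w (conj z 1ℤ (⟦ u ⟧ b) - ⟦ u ⟧ b)

  IsAppropriate : Embedding → Parameter → Set c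
  IsAppropriate u z = ∃[ i ] (1 ℕ.≤ i) × IsLocalHeight u z [ + i ] ×
    (∃[ b ] Central residueRing b × (¬ δ u z i b ≈ᵣ D̄.0#))

  -- i(u)
  IsSemilocalHeight : Embedding → ℤ∞ → Set c
  IsSemilocalHeight u = IsMaximum λ v → ∃[ z ] IsLocalHeight u z v

  -- i(u,b), computed with the parameter z
  record IsHeightOf (u : Embedding) (z : Parameter) (b : V) (i : ℕ) : Set c where
    field
      central  : Central residueRing b
      fixed    : α u z b ≈ᵣ b
      positive : 1 ℕ.≤ i
      nonzero  : ¬ δ u z i b ≈ᵣ D̄.0#
      minimal  : ∀ j → 1 ℕ.≤ j → j ℕ.< i → δ u z j b ≈ᵣ D̄.0#

  -- The value whose maximum over u and z is d_D(s), for i = i(u,s)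
  defect : Embedding → Parameter → V → ℕ → ℤ∞
  defect u z s i =
    w (conj z (ℤ.- + i) (⟦ u ⟧ s) - ⟦ u ⟧ s - ⟦ u ⟧ (δ[_] u z (ℤ.- + i) i s) * z ^ᶻ + i)

  -- d_D(s).  A maximum in ℕ ∪ {∞} is a supremum; when the values are
  -- unbounded, d_D(s) = ∞.
  IsMaximalDefect : V → ℤ∞ → Set (c ⊔ ℓ)
  IsMaximalDefect s = IsSupremum λ v → ∃[ u ] ∃[ z ] ∃[ i ]
    IsAppropriate u z × IsHeightOf u z s i × v ≡ defect u z s i

{-# OPTIONS --safe #-}
-- Let z attain the semilocal height i, and let j = i(u,a).  The conjugate
-- z⁻ʲ u(a) zʲ agrees with u(a) modulo zʲ, and d_D(a) measures what is left
-- after the zʲ-term is removed too, so it exceeds j ≥ i.  What remains is that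
-- j is finite.  If not, u(a) commutes with z and with u(D̄), hence with V_D;
-- since D̄ = F̄(a), every residue class then contains a central element of V_D,
-- so z commutes with V_D as well, which contradicts the finiteness of i.
module Submission where

open import Defs
open import Algebra.Bundles using (Ring)
import Algebra.Properties.AbelianGroup as AbelianGroupProperties
open import Algebra.Morphism.Structures using (module RingMorphisms)
import Algebra.Properties.Ring as RingProperties
import Algebra.Properties.Semiring.Exp as Exp
open import Axiom.ExcludedMiddle using (ExcludedMiddle)
open import Data.Empty using (⊥-elim)
open import Data.Integer.Base as ℤ using (ℤ; +_; -[1+_]; 0ℤ; 1ℤ)
import Data.Integer.Properties as ℤ
open import Data.Nat.Base as ℕ using (ℕ; zero; suc; _<_)
import Data.Nat.Properties as ℕ
open import Data.Nat.Divisibility using (_∣_; _∣0)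
open import Data.Product.Base using (∃-syntax; _×_; _,_; proj₁; proj₂)
open import Function.Bundles using (module Equivalence)
open import Relation.Binary.PropositionalEquality as ≡ using (_≡_)
open import Relation.Nullary.Decidable.Core using (Dec; yes; no)
open import Relation.Nullary.Negation.Core using (¬_)
open import Relation.Unary using (Pred; _∈_)

-- Order, addition and suprema in ℤ ∪ {∞}.

+∞-cancelʳ-≤ : ∀ {m} n v → [ m ℤ.+ n ] ≤⁺ v +∞ [ n ] → [ m ] ≤⁺ v
+∞-cancelʳ-≤ n ⊤⁺    _     = _ ≤⊤⁺
+∞-cancelʳ-≤ {m} n [ k ] [ p ] = [ ≡.subst₂ ℤ._≤_ (shift m) (shift k) (ℤ.+-monoˡ-≤ (ℤ.- n) p) ]
  where
  shift : ∀ j → (j ℤ.+ n) ℤ.+ ℤ.- n ≡ j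
  shift j = ≡.trans (ℤ.+-assoc j n (ℤ.- n))
    (≡.trans (≡.cong (ℤ._+_ j) (ℤ.+-inverseʳ n)) (ℤ.+-identityʳ j))

+∞-comm : ∀ v w → v +∞ w ≡ w +∞ v
+∞-comm [ m ] [ n ] = ≡.cong [_] (ℤ.+-comm m n)
+∞-comm [ _ ] ⊤⁺    = ≡.refl
+∞-comm ⊤⁺    [ _ ] = ≡.refl
+∞-comm ⊤⁺    ⊤⁺    = ≡.refl

+∞-cancelˡ-≤ : ∀ {m} n v → [ n ℤ.+ m ] ≤⁺ [ n ] +∞ v → [ m ] ≤⁺ v
+∞-cancelˡ-≤ {m} n v p = +∞-cancelʳ-≤ n v
  (≡.subst₂ _≤⁺_ (≡.cong [_] (ℤ.+-comm n m)) (+∞-comm [ n ] v) p)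

≤∞-respˡ : ∀ {m n v} → m ≡ n → [ m ] ≤⁺ v → [ n ] ≤⁺ v
≤∞-respˡ ≡.refl p = p

[]-mono : ∀ {m n} → m ℕ.≤ n → [ + m ] ≤⁺ [ + n ]
[]-mono p = [ ℤ.+≤+ p ]

0≮0 : ¬ [ 0ℤ ] <⁺ [ 0ℤ ]
0≮0 [ p ] = ℤ.<-irrefl ≡.refl p

unbounded⇒∞ : ∀ v → (∀ n → [ + n ] ≤⁺ v) → v ≡ ⊤⁺
unbounded⇒∞ ⊤⁺         _ = ≡.refl
unbounded⇒∞ [ + m ]    f with f (suc m)
... | [ ℤ.+≤+ p ] = ⊥-elim (ℕ.1+n≰n p)
unbounded⇒∞ [ -[1+ _ ] ] f with f 0
... | [ () ]

<-≤∞-trans : ∀ {u v w} → u <⁺ v → v ≤⁺ w → u <⁺ w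
<-≤∞-trans [ p ]    [ q ]     = [ ℤ.<-≤-trans p q ]
<-≤∞-trans [ p ]    (_ ≤⊤⁺)   = [ _ ]<⊤⁺
<-≤∞-trans [ _ ]<⊤⁺ (_ ≤⊤⁺)   = [ _ ]<⊤⁺

suc≤⇒<∞ : ∀ {n v} → [ + suc n ] ≤⁺ v → [ + n ] <⁺ v
suc≤⇒<∞ = <-≤∞-trans [ ℤ.+<+ (ℕ.n<1+n _) ]

-- Excluded middle decides whether `P` has an integer bound. Without one, ∞ is the only upper bound.
-- With one, the member of `P` is finite, and a descent from the bound towards this member reaches
-- the least bound after finitely many steps.
supremum-exists : ∀ {ℓ} → ExcludedMiddle ℓ → (P : Pred ℤ∞ ℓ) →
                  ∀ {v} → v ∈ P → ∃[ s ] IsSupremum P s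
supremum-exists {ℓ} em P v∈P = dichotomy em
  where
  Bound : ℤ → Set ℓ
  Bound n = ∀ {v} → v ∈ P → v ≤⁺ [ n ]

  descend : ∀ {m} → [ m ] ∈ P → ∀ k → Bound (+ k ℤ.+ m) → ∃[ s ] IsSupremum P s
  descend {m} m∈P zero b =
    [ m ] , (λ q → ≡.subst (λ j → _ ≤⁺ [ j ]) (ℤ.+-identityˡ m) (b q)) , λ _ f → f m∈P
  descend {m} m∈P (suc k) b with em {Bound (+ k ℤ.+ m)}
  ... | yes b′ = descend m∈P k b′
  -- An upper bound `j` with `j ≤ + k + m` would make `+ k + m` a bound too, so every bound is at
  -- least one larger.
  ... | no ¬b′ = [ + suc k ℤ.+ m ] , b , λ
    { ⊤⁺    _ → _ ≤⊤⁺
    ; [ j ] f → [ ≡.subst (ℤ._≤ j) (≡.sym (ℤ.+-assoc 1ℤ (+ k) m)) (ℤ.i<j⇒suc[i]≤j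
        (ℤ.≰⇒> λ j≤ → ¬b′ λ q → ≤∞-trans (f q) [ j≤ ])) ]
    }

  bounded : ∀ {v n} → v ∈ P → v ≤⁺ [ n ] → Bound n → ∃[ s ] IsSupremum P s
  bounded {[ m ]} {n} m∈P [ m≤n ] bound with n ℤ.- m in eq | ℤ.i≤j⇒0≤j-i m≤n
  ... | + k | _ = descend m∈P k (≡.subst Bound (≡.sym split) bound)
    where
    split : + k ℤ.+ m ≡ n
    split = ≡.trans (≡.cong (ℤ._+ m) (≡.sym eq))
      (≡.trans (ℤ.+-assoc n (ℤ.- m) m)
        (≡.trans (≡.cong (ℤ._+_ n) (ℤ.+-inverseˡ m)) (ℤ.+-identityʳ n)))

  dichotomy : Dec (∃[ n ] Bound n) → ∃[ s ] IsSupremum P s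
  dichotomy (yes (_ , bound)) = bounded v∈P (bound v∈P) bound
  dichotomy (no unbounded)    = ⊤⁺ , (λ _ → _ ≤⊤⁺) , λ
    { ⊤⁺    _ → _ ≤⊤⁺
    ; [ n ] q → ⊥-elim (unbounded (n , q))
    }

module Conjugation {k₁ k₂ c ℓ} {k : Field k₁ k₂} (D : DivisionAlgebra k c ℓ) where
  open DivisionAlgebra D
  open Residue D
  open Ring ring hiding (zero)
  open IsDivisionRing isDivisionRing
  open IsValuation isValuation renaming (cong to w-cong)
  open RingProperties ring using (x[y-z]≈xy-xz; [y-z]x≈yx-zx; -‿distribˡ-*; -‿distribʳ-*)
  open AbelianGroupProperties +-abelianGroup
    using (⁻¹-anti-homo‿-; ⁻¹-∙-comm; x≈y⇒x∙y⁻¹≈ε; x∙y⁻¹≈ε⇒x≈y; ε⁻¹≈ε)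
  open Exp semiring using (_^_; ^-homo-*)
  open Parameter using (element; element⁻¹; value; inverseˡ; inverseʳ)
  open Embedding using (⟦_⟧; section; isHomomorphism)
  open RingMorphisms D̄.rawRing V.rawRing using (module IsRingHomomorphism)
  open import Relation.Binary.Reasoning.Setoid setoid

  -- Valuations, residue classes and embeddings.

  x-0≈x : ∀ x → x - 0# ≈ x
  x-0≈x x = trans (+-congˡ ε⁻¹≈ε) (+-identityʳ x)

  w-*ˡ : ∀ {x y v} → w x ≡ v → w (x * y) ≡ v +∞ w y
  w-*ˡ {y = y} p = ≡.trans (mult _ _) (≡.cong (_+∞ w y) p)

  ≤w⇒≈ᵣ0 : ∀ x → [ 1ℤ ] ≤⁺ w (proj₁ x) → x ≈ᵣ D̄.0#
  ≤w⇒≈ᵣ0 x = 1≤w⇒≈ᵣ {x} {D̄.0#} (sym (x-0≈x _))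

  w≡0⇒≉ᵣ0 : ∀ x → w (proj₁ x) ≡ [ 0ℤ ] → ¬ x ≈ᵣ D̄.0#
  w≡0⇒≉ᵣ0 x p q = 0≮0 (≡.subst ([ 0ℤ ] <⁺_) (≡.trans (w-cong (x-0≈x _)) p) q)

  ≉ᵣ0⇒w≡0 : ∀ x → ¬ x ≈ᵣ D̄.0# → w (proj₁ x) ≡ [ 0ℤ ]
  ≉ᵣ0⇒w≡0 x x≉0 = unit (w (proj₁ x)) (proj₂ x) (λ p → x≉0 (≤w⇒≈ᵣ0 x p))
    where
    unit : ∀ v → [ 0ℤ ] ≤⁺ v → ¬ [ 1ℤ ] ≤⁺ v → v ≡ [ 0ℤ ]
    unit ⊤⁺          _    q = ⊥-elim (q (_ ≤⊤⁺))
    unit [ + zero ]  _    _ = ≡.refl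
    unit [ + suc n ] _    q = ⊥-elim (q [ ℤ.+≤+ (ℕ.s≤s ℕ.z≤n) ])
    unit [ -[1+ _ ] ] [ () ] _

  ⟦⟧-cong : ∀ u x y → x ≈ᵣ y → ⟦ u ⟧ x ≈ ⟦ u ⟧ y
  ⟦⟧-cong u x y = IsRingHomomorphism.⟦⟧-cong (isHomomorphism u) {x} {y}

  -- An embedding is defined on residue classes, so it sends elements of M_D to exactly zero.
  -- Vanishing coefficients therefore drop out of a partial sum without leaving an error term.
  ⟦⟧-0 : ∀ u x → x ≈ᵣ D̄.0# → ⟦ u ⟧ x ≈ 0#
  ⟦⟧-0 u x p = trans (⟦⟧-cong u x D̄.0# p) (IsRingHomomorphism.0#-homo (isHomomorphism u))

  -- Leading coefficients of the expansion of an element close to u(b).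

  module _ (u : Embedding) (z : Parameter) where
    open Series u z

    private
      w-z^ : ∀ n → w (element z ^ n) ≡ [ + n ]
      w-z^ n = w-^ᶻ z (+ n)

    module _ (x b : V) where

      -- Simultaneous induction with `remainder-w` and `remainder-≈ᵣ0`. Once the partial sum equals
      -- u(b), `remainder-sum` identifies the next remainder times a power of z with x - u(b), which
      -- fixes its valuation. If that valuation exceeds the exponent, the remainder lies in M_D, its
      -- term vanishes and the partial sum stays u(b).
      partialSum-≈ : ∀ n → [ + suc n ] ≤⁺ w (proj₁ x - ⟦ u ⟧ b) →
                     partialSum (remainder x) (suc n) ≈ ⟦ u ⟧ b

      remainder-w : ∀ n → [ + suc n ] ≤⁺ w (proj₁ x - ⟦ u ⟧ b) →
                    w (proj₁ (remainder x (suc n))) +∞ [ + suc n ] ≡ w (proj₁ x - ⟦ u ⟧ b)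
      remainder-w n p = ≡.trans (≡.cong (w (proj₁ (remainder x (suc n))) +∞_) (≡.sym (w-z^ (suc n))))
        (≡.trans (≡.sym (mult _ _)) (w-cong (trans (sym (remainder-sum x (suc n)))
          (+-congˡ (-‿cong (partialSum-≈ n p))))))

      remainder-≈ᵣ0 : ∀ n → [ + suc (suc n) ] ≤⁺ w (proj₁ x - ⟦ u ⟧ b) →
                      remainder x (suc n) ≈ᵣ D̄.0#
      remainder-≈ᵣ0 n p = ≤w⇒≈ᵣ0 (remainder x (suc n)) (+∞-cancelʳ-≤ (+ suc n) _
        (≤∞-resp (≡.sym (remainder-w n (≤∞-trans ([]-mono (ℕ.n≤1+n _)) p))) p))

      ≤w⇒≈ᵣ : [ 1ℤ ] ≤⁺ w (proj₁ x - ⟦ u ⟧ b) → x ≈ᵣ b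
      ≤w⇒≈ᵣ p = 1≤w⇒≈ᵣ {x} {b} (telescope _ (⟦ u ⟧ b) _) (ultrametric _ _ p (0<⇒1≤ (section u b)))

      partialSum-≈ zero p = begin
        0# + ⟦ u ⟧ x * 1#  ≈⟨ +-identityˡ _ ⟩
        ⟦ u ⟧ x * 1#       ≈⟨ *-identityʳ _ ⟩
        ⟦ u ⟧ x            ≈⟨ ⟦⟧-cong u x b (≤w⇒≈ᵣ p) ⟩
        ⟦ u ⟧ b            ∎
      partialSum-≈ (suc n) p = begin
        partialSum (remainder x) (suc n) + ⟦ u ⟧ (remainder x (suc n)) * element z ^ suc n
          ≈⟨ +-cong (partialSum-≈ n (≤∞-trans ([]-mono (ℕ.n≤1+n _)) p))
                    (*-congʳ (⟦⟧-0 u (remainder x (suc n)) (remainder-≈ᵣ0 n p))) ⟩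
        ⟦ u ⟧ b + 0# * element z ^ suc n  ≈⟨ +-congˡ (zeroˡ _) ⟩
        ⟦ u ⟧ b + 0#                      ≈⟨ +-identityʳ _ ⟩
        ⟦ u ⟧ b                           ∎

      -- When x - u(b) has order exactly `suc n`, dividing out that power of z leaves a unit. This
      -- yields the nonvanishing of δ at the height.
      remainder-≉ᵣ0 : ∀ n → w (proj₁ x - ⟦ u ⟧ b) ≡ [ + suc n ] →
                      ¬ remainder x (suc n) ≈ᵣ D̄.0#
      remainder-≉ᵣ0 n p = w≡0⇒≉ᵣ0 (remainder x (suc n))
        (solve _ (≡.trans (remainder-w n (≤∞-resp (≡.sym p) ≤∞-refl)) p))
        where
        solve : ∀ v → v +∞ [ + suc n ] ≡ [ + suc n ] → v ≡ [ 0ℤ ]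
        solve [ m ] q = ≡.cong [_] (ℤG.identityˡ-unique m (+ suc n) ([]-injective q))

      -- The terms of degree at most `n` add up to u(b), so the expression is the error of the
      -- expansion cut off after degree `suc n`. It has the shape of `defect`.
      remainder-approximates : ∀ n → [ + suc n ] ≤⁺ w (proj₁ x - ⟦ u ⟧ b) →
        [ + suc (suc n) ] ≤⁺
        w (proj₁ x - ⟦ u ⟧ b - ⟦ u ⟧ (remainder x (suc n)) * element z ^ suc n)
      remainder-approximates n p = ≤∞-resp (w-cong (begin
        proj₁ x - (S + t)       ≈⟨ +-congˡ (⁻¹-∙-comm S t) ⟨
        proj₁ x + (- S - t)     ≈⟨ +-assoc _ _ _ ⟨
        (proj₁ x - S) - t       ≈⟨ +-congʳ (+-congˡ (-‿cong (partialSum-≈ n p))) ⟩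
        proj₁ x - ⟦ u ⟧ b - t   ∎)) (proj₂ (expansion x) (suc (suc n)))
        where
        S t : Carrier
        S = partialSum (remainder x) (suc n)
        t = ⟦ u ⟧ (remainder x (suc n)) * element z ^ suc n

  -- Conjugation by powers of a parameter.

  ^-inverse : ∀ z n → element z ^ n * element⁻¹ z ^ n ≈ 1#
  ^-inverse z zero    = *-identityˡ 1#
  ^-inverse z (suc n) = begin
    (t * t ^ n) * t⁻¹ ^ suc n      ≈⟨ *-congˡ (*-comm-^ t⁻¹ n) ⟩
    (t * t ^ n) * (t⁻¹ ^ n * t⁻¹)  ≈⟨ *-assoc t _ _ ⟩
    t * (t ^ n * (t⁻¹ ^ n * t⁻¹))  ≈⟨ *-congˡ (*-assoc _ _ _) ⟨
    t * (t ^ n * t⁻¹ ^ n * t⁻¹)    ≈⟨ *-congˡ (*-congʳ (^-inverse z n)) ⟩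
    t * (1# * t⁻¹)                 ≈⟨ *-congˡ (*-identityˡ _) ⟩
    t * t⁻¹                        ≈⟨ inverseʳ z ⟩
    1#                             ∎
    where
    t t⁻¹ : Carrier
    t = element z
    t⁻¹ = element⁻¹ z

    *-comm-^ : ∀ x n → x * x ^ n ≈ x ^ n * x
    *-comm-^ x n = begin
      x ^ suc n       ≡⟨ ≡.cong (x ^_) (ℕ.+-comm 1 n) ⟩
      x ^ (n ℕ.+ 1)   ≈⟨ ^-homo-* x n 1 ⟩
      x ^ n * x ^ 1   ≈⟨ *-congˡ (*-identityʳ x) ⟩
      x ^ n * x       ∎

  -- Clearing the inverse by a factor z on the right trades conjugation for a commutator, to which a
  -- Leibniz rule applies.
  conj-1-commutator : ∀ z y → (conj z 1ℤ y - y) * element z ≈ element z * y - y * element z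
  conj-1-commutator z y = trans ([y-z]x≈yx-zx _ _ _) (+-congʳ (begin
    (t * 1#) * y * (t⁻¹ * 1#) * t  ≈⟨ *-congʳ (*-cong (*-congʳ (*-identityʳ t)) (*-identityʳ t⁻¹)) ⟩
    t * y * t⁻¹ * t                ≈⟨ *-assoc _ _ _ ⟩
    t * y * (t⁻¹ * t)              ≈⟨ *-congˡ (inverseˡ z) ⟩
    t * y * 1#                     ≈⟨ *-identityʳ _ ⟩
    t * y                          ∎))
    where
    t t⁻¹ : Carrier
    t = element z
    t⁻¹ = element⁻¹ z

  -- Induction by the Leibniz rule [y, tⁿ⁺¹] = [y, t] tⁿ + t [y, tⁿ]. The first summand has order at
  -- least (e + 1) + n by `conj-1-commutator`, the second at least 1 + (n + e) by induction.
  ^-commutator-w : ∀ z y {e} → [ e ] ≤⁺ w (conj z 1ℤ y - y) →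
                   ∀ n → [ + n ℤ.+ e ] ≤⁺ w (y * element z ^ n - element z ^ n * y)
  ^-commutator-w z y     p zero    = ≤w-0
    (x≈y⇒x∙y⁻¹≈ε (trans (*-identityʳ y) (sym (*-identityˡ y))))
  ^-commutator-w z y {e} p (suc n) = ≤∞-resp (w-cong (begin
    (y * t - t * y) * t ^ n + t * (y * t ^ n - t ^ n * y)
      ≈⟨ +-cong ([y-z]x≈yx-zx _ _ _) (x[y-z]≈xy-xz _ _ _) ⟩
    (y * t * t ^ n - t * y * t ^ n) + (t * (y * t ^ n) - t * (t ^ n * y))
      ≈⟨ +-cong (+-cong (*-assoc _ _ _) (-‿cong (*-assoc _ _ _)))
                (+-congˡ (-‿cong (sym (*-assoc _ _ _)))) ⟩
    (y * t ^ suc n - t * (y * t ^ n)) + (t * (y * t ^ n) - t ^ suc n * y)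
      ≈⟨ telescope _ _ _ ⟩
    y * t ^ suc n - t ^ suc n * y
      ∎))
    (ultrametric _ _
      (≤∞-respˡ first
        (≤w-* _ _ (≤∞-resp (w-cong (⁻¹-anti-homo‿- _ _)) (≤w-neg _ commutator))
                  (≤∞-resp (≡.sym (w-^ᶻ z (+ n))) ≤∞-refl)))
      (≤∞-respˡ (≡.sym (ℤ.+-assoc 1ℤ (+ n) e))
        (≤w-* _ _ (≤∞-resp (≡.sym (value z)) ≤∞-refl) (^-commutator-w z y p n))))
    where
    t : Carrier
    t = element z

    commutator : [ e ℤ.+ 1ℤ ] ≤⁺ w (t * y - y * t)
    commutator = ≤∞-resp (w-cong (conj-1-commutator z y))
      (≤w-* _ _ p (≤∞-resp (≡.sym (value z)) ≤∞-refl))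

    first : e ℤ.+ 1ℤ ℤ.+ + n ≡ + suc n ℤ.+ e
    first = ≡.trans (ℤ.+-assoc e 1ℤ (+ n)) (ℤ.+-comm e (+ suc n))

  -- A factor tⁿ⁺¹ on the left turns the difference into the commutator of y with tⁿ⁺¹. The n + 1
  -- gained in `^-commutator-w` is exactly the order of this factor and cancels.
  conj-neg-w : ∀ z y {e} → [ e ] ≤⁺ w (conj z 1ℤ y - y) →
               ∀ n → [ e ] ≤⁺ w (conj z (ℤ.- + suc n) y - y)
  conj-neg-w z y p n = +∞-cancelˡ-≤ (+ suc n) _ (≤∞-resp
    (≡.trans (≡.sym (w-cong (begin
      t ^ suc n * (t⁻¹ ^ suc n * y * t ^ suc n - y)
        ≈⟨ x[y-z]≈xy-xz _ _ _ ⟩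
      t ^ suc n * (t⁻¹ ^ suc n * y * t ^ suc n) - t ^ suc n * y
        ≈⟨ +-congʳ cancel ⟩
      y * t ^ suc n - t ^ suc n * y
        ∎)))
      (w-*ˡ (w-^ᶻ z (+ suc n))))
    (^-commutator-w z y p (suc n)))
    where
    t t⁻¹ : Carrier
    t = element z
    t⁻¹ = element⁻¹ z

    cancel : t ^ suc n * (t⁻¹ ^ suc n * y * t ^ suc n) ≈ y * t ^ suc n
    cancel = begin
      t ^ suc n * (t⁻¹ ^ suc n * y * t ^ suc n)   ≈⟨ *-assoc _ _ _ ⟨
      t ^ suc n * (t⁻¹ ^ suc n * y) * t ^ suc n   ≈⟨ *-congʳ (*-assoc _ _ _) ⟨
      t ^ suc n * t⁻¹ ^ suc n * y * t ^ suc n     ≈⟨ *-congʳ (*-congʳ (^-inverse z (suc n))) ⟩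
      1# * y * t ^ suc n                          ≈⟨ *-congʳ (*-identityˡ y) ⟩
      y * t ^ suc n                               ∎

  -- By `conj-neg-w` the conjugate under the negative power also agrees with u(s) up to order
  -- `suc n`. Since `defect` removes the term of that degree as well, the order rises by at least
  -- one.
  defect-> : ∀ u z s n → [ + suc n ] ≤⁺ w (conj z 1ℤ (⟦ u ⟧ s) - ⟦ u ⟧ s) →
             [ + suc (suc n) ] ≤⁺ defect u z s (suc n)
  defect-> u z s n p = remainder-approximates u z _ s n (conj-neg-w z (⟦ u ⟧ s) p n)

  -- Passes from the valuation description of i(u,s) to the one by coefficients: those strictly
  -- between degree 0 and the order vanish, and the one at the order is a unit.
  isHeightOf : ∀ u z s n → Central residueRing s →
               w (conj z 1ℤ (⟦ u ⟧ s) - ⟦ u ⟧ s) ≡ [ + suc n ] → IsHeightOf u z s (suc n)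
  isHeightOf u z s n s-central eq = record
    { central  = s-central
    ; fixed    = ≤w⇒≈ᵣ u z (_ , conj-integral z 1ℤ _ (proj₂ (Embedding.map u s))) s (≥w (ℕ.s≤s ℕ.z≤n))
    ; positive = ℕ.s≤s ℕ.z≤n
    ; nonzero  = remainder-≉ᵣ0 u z _ s n eq
    ; minimal  = λ { (suc j) _ j<n → remainder-≈ᵣ0 u z _ s j (≥w j<n) }
    }
    where
    ≥w : ∀ {m} → m ℕ.≤ suc n → [ + m ] ≤⁺ w (conj z 1ℤ (⟦ u ⟧ s) - ⟦ u ⟧ s)
    ≥w m≤n = ≤∞-resp (≡.sym eq) ([]-mono m≤n)

  -- Centralizers and z-adic approximation.

  Commute : Carrier → Carrier → Set ℓ
  Commute x y = x * y ≈ y * x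

  commute-+ : ∀ {x y y′} → Commute x y → Commute x y′ → Commute x (y + y′)
  commute-+ p q = trans (distribˡ _ _ _) (trans (+-cong p q) (sym (distribʳ _ _ _)))

  commute-neg : ∀ {x y} → Commute x y → Commute x (- y)
  commute-neg p = trans (sym (-‿distribʳ-* _ _)) (trans (-‿cong p) (-‿distribˡ-* _ _))

  commute-* : ∀ {x y y′} → Commute x y → Commute x y′ → Commute x (y * y′)
  commute-* p q = trans (sym (*-assoc _ _ _)) (trans (*-congʳ p)
    (trans (*-assoc _ _ _) (trans (*-congˡ q) (sym (*-assoc _ _ _)))))

  commute-inverse : ∀ {x y y′} → y * y′ ≈ 1# → y′ * y ≈ 1# → Commute x y → Commute x y′
  commute-inverse {x} {y} {y′} r l p = begin
    x * y′              ≈⟨ *-congʳ (*-identityˡ x) ⟨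
    1# * x * y′         ≈⟨ *-congʳ (*-congʳ l) ⟨
    y′ * y * x * y′     ≈⟨ *-congʳ (*-assoc _ _ _) ⟩
    y′ * (y * x) * y′   ≈⟨ *-congʳ (*-congˡ p) ⟨
    y′ * (x * y) * y′   ≈⟨ *-congʳ (*-assoc _ _ _) ⟨
    y′ * x * y * y′     ≈⟨ *-assoc _ _ _ ⟩
    y′ * x * (y * y′)   ≈⟨ *-congˡ r ⟩
    y′ * x * 1#         ≈⟨ *-identityʳ _ ⟩
    y′ * x              ∎

  module _ (z : Parameter) {y : Carrier} (y-integral : [ 0ℤ ] ≤⁺ w y)
           (yz≈zy : Commute y (element z))
           (representative : ∀ x → ∃[ x′ ] x ≈ᵣ x′ × Commute y (proj₁ x′)) where

    -- Digit by digit: subtract a commuting representative of the residue class of x, divide by z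
    -- and repeat. The resulting polynomial in z commutes with y because its digits and z do.
    commuting-approximation : ∀ n (x : V) → ∃[ s ] Commute y s × [ + n ] ≤⁺ w (proj₁ x - s)
    commuting-approximation zero (x , p) =
      0# , trans (zeroʳ y) (sym (zeroˡ y)) , ≤∞-resp (w-cong (sym (x-0≈x x))) p
    commuting-approximation (suc n) x₀@(x , _) = step (representative x₀)
      where
      t t⁻¹ : Carrier
      t = element z
      t⁻¹ = element⁻¹ z

      step : ∃[ x′ ] x₀ ≈ᵣ x′ × Commute y (proj₁ x′) →
             ∃[ s ] Commute y s × [ + suc n ] ≤⁺ w (x - s)
      step ((x′ , _) , x≈x′ , yx′) = s , commute-+ yx′ (commute-* (proj₁ (proj₂ rest)) yz≈zy) ,
        ≤∞-resp (w-cong (begin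
          (q - s′) * t            ≈⟨ [y-z]x≈yx-zx _ _ _ ⟩
          q * t - s′ * t          ≈⟨ +-congʳ qt ⟩
          (x - x′) - s′ * t       ≈⟨ +-assoc _ _ _ ⟩
          x + (- x′ - s′ * t)     ≈⟨ +-congˡ (⁻¹-∙-comm _ _) ⟩
          x - s                   ∎))
        (≤∞-respˡ (ℤ.+-comm (+ n) 1ℤ)
          (≤w-* _ _ (proj₂ (proj₂ rest)) (≤∞-resp (≡.sym (value z)) ≤∞-refl)))
        where
        q s s′ : Carrier
        -- This quotient is integral because x and x′ have the same residue, so the recursion
        -- applies to it. Multiplying back by t raises the precision from `n` to `suc n`.
        q = (x - x′) * t⁻¹

        rest : ∃[ s ] Commute y s × [ + n ] ≤⁺ w (q - s)
        rest = commuting-approximation n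
          (q , ≤w-* _ _ (0<⇒1≤ x≈x′) (≤∞-resp (≡.sym (w-element⁻¹ z)) ≤∞-refl))

        s′ = proj₁ rest
        s = x′ + s′ * t

        qt : q * t ≈ x - x′
        qt = trans (*-assoc _ _ _) (trans (*-congˡ (inverseˡ z)) (*-identityʳ _))

    -- If y commutes with s, then [y, x] = [y, x - s]. With s arbitrarily close to x and y integral,
    -- the commutator has order at least every `n`, hence is zero. It is applied first to y = u(a)
    -- with representatives in the image of u, then to y = z with central representatives.
    commutes-with-V : ∀ (x : V) → Commute y (proj₁ x)
    commutes-with-V x₀@(x , _) = x∙y⁻¹≈ε⇒x≈y _ _
      (Equivalence.to (infinite _) (unbounded⇒∞ _ bound))
      where
      bound : ∀ n → [ + n ] ≤⁺ w (y * x - x * y)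
      bound n with commuting-approximation n x₀
      ... | s , ys≈sy , p = ≤∞-resp (w-cong (begin
        y * (x - s) - (x - s) * y
          ≈⟨ +-cong (x[y-z]≈xy-xz _ _ _) (-‿cong ([y-z]x≈yx-zx _ _ _)) ⟩
        (y * x - y * s) - (x * y - s * y)
          ≈⟨ +-congˡ (⁻¹-anti-homo‿- _ _) ⟩
        (y * x - y * s) + (s * y - x * y)
          ≈⟨ +-congʳ (+-congˡ (-‿cong ys≈sy)) ⟩
        (y * x - s * y) + (s * y - x * y)
          ≈⟨ telescope _ _ _ ⟩
        y * x - x * y
          ∎))
        (≤w-- _ _ (≤∞-respˡ (ℤ.+-identityˡ (+ n)) (≤w-* _ _ y-integral p))
                  (≤∞-respˡ (ℤ.+-identityʳ (+ n)) (≤w-* _ _ p y-integral)))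

  -- Residue classes represented by central elements of V_D.

  HasCentralLift : Pred V _
  HasCentralLift x = ∃[ y ] Central valuationRing y × x ≈ᵣ y

  module _ {s : V} (s-lift : HasCentralLift s) where

    -- Classes with a central lift contain F̄, because F is central, and are closed under the ring
    -- operations. For inverses, the lift of an invertible class has valuation 0, so its inverse in
    -- D is integral, and it is again central.
    F̄⟨⟩⇒centralLift : ∀ {x} → x ∈ F̄⟨ s ⟩ → HasCentralLift x
    F̄⟨⟩⇒centralLift (base (f , p , x≈ιf)) = (ι f , p) , (λ v → ι-central f (proj₁ v)) , x≈ιf
    F̄⟨⟩⇒centralLift gen = s-lift
    F̄⟨⟩⇒centralLift (resp {x} {y} x≈y x∈) with F̄⟨⟩⇒centralLift x∈
    ... | x′ , cx , x≈x′ = x′ , cx , D̄.trans {y} {x} {x′} (D̄.sym {x} {y} x≈y) x≈x′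
    F̄⟨⟩⇒centralLift (add {x} {y} x∈ y∈) with F̄⟨⟩⇒centralLift x∈ | F̄⟨⟩⇒centralLift y∈
    ... | x′ , cx , x≈x′ | y′ , cy , y≈y′ =
      x′ V.+ y′ , (λ v → sym (commute-+ (sym (cx v)) (sym (cy v)))) ,
      D̄.+-cong {x} {x′} {y} {y′} x≈x′ y≈y′
    F̄⟨⟩⇒centralLift (neg {x} x∈) with F̄⟨⟩⇒centralLift x∈
    ... | x′ , cx , x≈x′ =
      V.- x′ , (λ v → sym (commute-neg (sym (cx v)))) , D̄.-‿cong {x} {x′} x≈x′
    F̄⟨⟩⇒centralLift (mul {x} {y} x∈ y∈) with F̄⟨⟩⇒centralLift x∈ | F̄⟨⟩⇒centralLift y∈
    ... | x′ , cx , x≈x′ | y′ , cy , y≈y′ =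
      x′ V.* y′ , (λ v → sym (commute-* (sym (cx v)) (sym (cy v)))) ,
      D̄.*-cong {x} {x′} {y} {y′} x≈x′ y≈y′
    F̄⟨⟩⇒centralLift (inv {x} {y} xy≈1 x∈) with F̄⟨⟩⇒centralLift x∈
    ... | x′ , cx , x≈x′ =
      x⁻¹ , (λ v → sym (commute-inverse (proj₁ (proj₂ x′-inv)) (proj₂ (proj₂ x′-inv)) (sym (cx v)))) ,
      y≈x⁻¹
      where
      x′y≈1 : x′ V.* y ≈ᵣ D̄.1#
      x′y≈1 = D̄.trans {x′ V.* y} {x V.* y} {D̄.1#}
        (D̄.*-cong {x′} {x} {y} {y} (D̄.sym {x} {x′} x≈x′) (D̄.refl {y})) xy≈1

      x′≉0 : ¬ x′ ≈ᵣ D̄.0#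
      x′≉0 x′≈0 = w≡0⇒≉ᵣ0 D̄.1# w-1
        (D̄.trans {D̄.1#} {x′ V.* y} {D̄.0#} (D̄.sym {x′ V.* y} {D̄.1#} x′y≈1)
          (D̄.trans {x′ V.* y} {D̄.0# V.* y} {D̄.0#}
            (D̄.*-cong {x′} {D̄.0#} {y} {y} x′≈0 (D̄.refl {y}))
            (D̄.zeroˡ y)))

      x′-inv : ∃[ v ] (proj₁ x′ * v ≈ 1#) × (v * proj₁ x′ ≈ 1#)
      x′-inv = inverse (proj₁ x′) λ x′≈0 → x′≉0 (≈⇒≈ᵣ {x′} {D̄.0#} x′≈0)

      x⁻¹-integral : [ 0ℤ ] ≤⁺ w (proj₁ x′-inv)
      x⁻¹-integral = +∞-cancelˡ-≤ 0ℤ _ (≤∞-resp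
        (≡.trans (≡.sym (≡.trans (w-cong (proj₁ (proj₂ x′-inv))) w-1))
          (w-*ˡ (≉ᵣ0⇒w≡0 x′ x′≉0))) ≤∞-refl)

      x⁻¹ : V
      x⁻¹ = proj₁ x′-inv , x⁻¹-integral

      y≈x⁻¹ : y ≈ᵣ x⁻¹
      y≈x⁻¹ = D̄.trans {y} {x⁻¹ V.* (x′ V.* y)} {x⁻¹}
        (≈⇒≈ᵣ {y} {x⁻¹ V.* (x′ V.* y)} (sym (begin
          proj₁ x⁻¹ * (proj₁ x′ * proj₁ y)  ≈⟨ *-assoc _ _ _ ⟨
          proj₁ x⁻¹ * proj₁ x′ * proj₁ y    ≈⟨ *-congʳ (proj₂ (proj₂ x′-inv)) ⟩
          1# * proj₁ y                      ≈⟨ *-identityˡ _ ⟩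
          proj₁ y                           ∎)))
        (D̄.trans {x⁻¹ V.* (x′ V.* y)} {x⁻¹ V.* D̄.1#} {x⁻¹}
          (D̄.*-cong {x⁻¹} {x⁻¹} {x′ V.* y} {D̄.1#} (D̄.refl {x⁻¹}) x′y≈1)
          (D̄.*-identityʳ x⁻¹))

  -- Finiteness of the height of the generator.

  conj-∞⇒commute : ∀ z y → w (conj z 1ℤ y - y) ≡ ⊤⁺ → Commute (element z) y
  conj-∞⇒commute z y p = x∙y⁻¹≈ε⇒x≈y _ _ (trans (sym (conj-1-commutator z y))
    (trans (*-congʳ (Equivalence.to (infinite _) p)) (zeroˡ _)))

  commute⇒conj-∞ : ∀ z y → Commute (element z) y → w (conj z 1ℤ y - y) ≡ ⊤⁺
  commute⇒conj-∞ z y p = solve _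
    (≡.trans (≡.cong (w (conj z 1ℤ y - y) +∞_) (≡.sym (value z)))
    (≡.trans (≡.sym (mult _ _))
      (≡.trans (w-cong (trans (conj-1-commutator z y) (x≈y⇒x∙y⁻¹≈ε p))) w-0)))
    where
    solve : ∀ v → v +∞ [ 1ℤ ] ≡ ⊤⁺ → v ≡ ⊤⁺
    solve ⊤⁺ _ = ≡.refl

  -- Two passes of `commutes-with-V`. If z commutes with u(a), the first makes u(a) central in V_D.
  -- Then every class in D̄ = F̄(a) has a central lift, and the second makes z commute with V_D, in
  -- particular with u(b).
  generator-noncentral : ∀ u z a → (∀ x → Central residueRing x) → (∀ x → x ∈ F̄⟨ a ⟩) →
    ∀ b → ¬ w (conj z 1ℤ (⟦ u ⟧ b) - ⟦ u ⟧ b) ≡ ⊤⁺ →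
    ¬ w (conj z 1ℤ (⟦ u ⟧ a) - ⟦ u ⟧ a) ≡ ⊤⁺
  generator-noncentral u z a D̄-comm D̄≡F̄⟨a⟩ b b≢∞ a≡∞ =
    b≢∞ (commute⇒conj-∞ z _ (z-central (Embedding.map u b)))
    where
    open IsRingHomomorphism (isHomomorphism u) using (*-homo)

    uu-commute : ∀ x → Commute (⟦ u ⟧ a) (⟦ u ⟧ x)
    uu-commute x = trans (sym (*-homo a x))
      (trans (⟦⟧-cong u (a V.* x) (x V.* a) (D̄-comm a x)) (*-homo x a))

    ua-central : Central valuationRing (Embedding.map u a)
    ua-central = commutes-with-V z (proj₂ (Embedding.map u a)) (sym (conj-∞⇒commute z _ a≡∞))
      λ x → Embedding.map u x , D̄.sym {Embedding.map u x} {x} (section u x) , uu-commute x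

    z-integral : [ 0ℤ ] ≤⁺ w (element z)
    z-integral = 1≤⇒0≤ (≤∞-resp (≡.sym (value z)) ≤∞-refl)

    z-central : ∀ (x : V) → Commute (element z) (proj₁ x)
    z-central = commutes-with-V z z-integral refl representative
      where
      representative : ∀ x → ∃[ x′ ] x ≈ᵣ x′ × Commute (element z) (proj₁ x′)
      representative x with F̄⟨⟩⇒centralLift
        (Embedding.map u a , ua-central , D̄.sym {Embedding.map u a} {a} (section u a)) (D̄≡F̄⟨a⟩ x)
      ... | x′ , cx , x≈x′ = x′ , x≈x′ , sym (cx (element z , z-integral))

theorem4 :
    (∀ {e} → ExcludedMiddle e) →
    ∀ {k₁ k₂ c ℓ} (k : Field k₁ k₂) (D : DivisionAlgebra k c ℓ) (p : ℕ) →
    let open DivisionAlgebra D using (ring)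
        open Residue D
    in
    HasCharacteristic ring p →
    2 < p →
    IsPAlgebra p D →
    (∀ x → Central residueRing x) →
    IsPurelyInseparable p →
    (a : V) → (∀ x → x ∈ F̄⟨ a ⟩) →
    (u : Embedding) (i : ℕ) →
    IsSemilocalHeight u [ + i ] →
    ¬ (p ∣ i) →
    ∃[ d ] IsMaximalDefect a d × ([ + i ] <⁺ d)
-- Height 0 is excluded because every p divides 0.
theorem4 _ k D p _ _ _ _ _ a _ u zero _ p∤0 = ⊥-elim (p∤0 (p ∣0))
theorem4 em k D p _ _ _ D̄-comm _ a D̄≡F̄⟨a⟩ u (suc i) ((z , height@((b , i≡wb) , i≤)) , _) _ =
  conclude _ ≡.refl
  where
  open DivisionAlgebra D
  open Ring ring using (_-_)
  open Residue D
  open Embedding using (⟦_⟧)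
  open Conjugation D

  -- The witness is the b at which the local height is attained: its δ at that height is nonzero,
  -- and it is central since D̄ is commutative.
  appropriate : IsAppropriate u z
  appropriate = suc i , ℕ.s≤s ℕ.z≤n , height , b , D̄-comm b ,
    IsHeightOf.nonzero (isHeightOf u z b i (D̄-comm b) (≡.sym i≡wb))

  b≢∞ : ¬ w (conj z 1ℤ (⟦ u ⟧ b) - ⟦ u ⟧ b) ≡ ⊤⁺
  b≢∞ p with () ← ≡.trans i≡wb p

  conclude : ∀ v → w (conj z 1ℤ (⟦ u ⟧ a) - ⟦ u ⟧ a) ≡ v →
             ∃[ d ] IsMaximalDefect a d × ([ + suc i ] <⁺ d)
  conclude ⊤⁺ eq = ⊥-elim (generator-noncentral u z a D̄-comm D̄≡F̄⟨a⟩ b b≢∞ eq)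
  -- The local height is a minimum over all of D̄, so the order at a is at least `suc i`.
  conclude [ n ] eq with ≤∞-resp eq (i≤ (a , ≡.refl))
  -- With `suc i` the semilocal height and `suc j` = i(u,a), the chain is i + 2 ≤ j + 2 ≤
  -- `defect u z a (suc j)` ≤ d.
  conclude [ + suc j ] eq | [ i≤j ] = d , sup , suc≤⇒<∞ (≤∞-trans [ ℤ.suc-mono i≤j ]
    (≤∞-trans (defect-> u z a j (≤∞-resp (≡.sym eq) ≤∞-refl)) (proj₁ sup defect∈)))
    where
    defect∈ : ∃[ u′ ] ∃[ z′ ] ∃[ m ]
      IsAppropriate u′ z′ × IsHeightOf u′ z′ a m × defect u z a (suc j) ≡ defect u′ z′ a m
    defect∈ = u , z , suc j , appropriate , isHeightOf u z a j (D̄-comm a) eq , ≡.refl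

    maximalDefect : ∃[ d ] IsMaximalDefect a d
    maximalDefect = supremum-exists em _ defect∈

    d : ℤ∞
    d = proj₁ maximalDefect

    sup : IsMaximalDefect a d
    sup = proj₂ maximalDefect
  conclude [ + zero ] eq | [ ℤ.+≤+ () ]
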